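{- Let $M$ be a matroid on a finite ground set and let $\mathbb H_1$ be a sub-hyperfield of a hyperfield $\mathbb H_2$. Then there exist injections $$i:\mathcal M^w_{\mathbb H_1}(M)\hookrightarrow\mathcal M^w_{\mathbb H_2}(M),\qquad j:\mathcal R^w_{\mathbb H_1}(M)\hookrightarrow\mathcal R^w_{\mathbb H_2}(M),$$ which are continuous when $\mathbb H_1,\mathbb H_2$ are topological hyperfields and the inclusion $\mathbb H_1\hookrightarrow\mathbb H_2$ is continuous. The same holds in the strong case (superscript $s$ in place of $w$).
   Context: A hyperfield is $(\mathbb H,\boxplus,\odot,0,1)$ with $0\ne1$ where: $\boxplus$ is a commutative, associative hyperoperation (each $a\boxplus b$ is a nonempty subset of $\mathbb H$; for subsets, $A\boxplus B=\bigcup_{a\in A,b\in B}a\boxplus b$) with $0\boxplus x=\{x\}$, each $x$ has a unique $-x$ with $0\in x\boxplus -x$, and $x\in y\boxplus z\iff z\in x\boxplus -y$; $(\mathbb H,\odot,1)$ is a commutative monoid, $0\odot x=0$, $a\odot(x\boxplus y)=(a\odot x)\boxplus(a\odot y)$; and $\mathbb H^*=\mathbb H\setminus\{0\}$ is a group under $\odot$. A sub-hyperfield of $\mathbb H_2$ is a subset $\mathbb H_1\subseteq\mathbb H_2$ that is itself a hyperfield with respect to the operations induced by $\mathbb H_2$. A topological hyperfield carries a topology with $\mathbb H^*$ open, $\odot$ continuous on $\mathbb H\times\mathbb H$, and inversion continuous on $\mathbb H^*$. Let $d$ be the rank and $E$ the ground set of $M$. A strong Grassmann–Plücker function of rank $d$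 with values in $\mathbb H$ is a nonzero alternating $\varphi:E^d\to\mathbb H$ with $0\in\boxplus_{k=1}^{d+1}(-1)^k\odot\varphi(x_1,\dots,\hat x_k,\dots,x_{d+1})\odot\varphi(x_k,y_1,\dots,y_{d-1})$ for all subsets $I=\{x_1,\dots,x_{d+1}\}$, $J=\{y_1,\dots,y_{d-1}\}$ of $E$; a weak one is a nonzero alternating function whose support is the set of bases of a matroid and for which this holds whenever $|I\setminus J|\le3$. Its underlying matroid is the one whose bases form the support of $\varphi$. $\mathcal M^w_{\mathbb H}(M)$ (resp. $\mathcal M^s_{\mathbb H}(M)$), the space of weak (resp. strong) $\mathbb H$-matroids with underlying matroid $M$, is the set of weak (resp. strong) Grassmann–Plücker functions with underlying matroid $M$ (topologized as a subset of $\mathbb H^{E^d}$) modulo $\varphi\sim a\odot\varphi$, $a\in\mathbb H^*$. $\mathcal R^w_{\mathbb H}(M)$ (resp. $\mathcal R^s_{\mathbb H}(M)$), the space of rescaling classes, is the quotient of $\mathcal M^w_{\mathbb H}(M)$ (resp. $\mathcal M^s_{\mathbb H}(M)$) by the relation identifying the class of $\varphi$ with that of $(x_1,\dots,x_d)\mapsto\left(\bigodot_{l=1}^dh(x_l)\right)\odot\varphi(x_1,\dots,x_d)$ for every $h:E\to\mathbb H^*$. Quotients carry the quotient topology. -}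

module Defs where

open import Level using (Level; suc)
open import Algebra.Bundles using (CommutativeSemigroup)
open import Algebra.Structures using (IsCommutativeMonoid; IsGroup)
open import Data.Bool.Base using (Bool; T)
open import Data.Fin.Base using (Fin; toℕ) renaming (zero to fzero; suc to fsuc)
open import Data.Fin.Subset as Subset using (Subset; ⁅_⁆; _∪_; _─_; _-_; ∣_∣)
open import Data.List.Base using (List; []; _++_)
open import Data.List.Relation.Unary.All as All using (All)
open import Data.List.Relation.Unary.All.Properties using (++⁻ˡ; ++⁻ʳ)
open import Data.Nat.Base as ℕ using (ℕ; zero)
open import Data.Product using (∃!)
open import Data.Product.Base
  using (Σ; Σ-syntax; ∃; ∃-syntax; _×_; _,_; proj₁; proj₂)
open import Data.Product.Relation.Binary.Pointwise.NonDependent using (_×ₛ_)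
open import Data.Unit.Base using (⊤)
open import Data.Vec.Base as Vec using (Vec; []; _∷_; lookup; removeAt; _[_]≔_)
open import Data.Vec.Relation.Unary.Unique.Propositional using (Unique)
open import Function.Base using (_∘_)
open import Function.Bundles using (_⇔_)
open import Relation.Binary.Bundles using (Setoid)
open import Relation.Binary.Core using (Rel)
open import Relation.Binary.Definitions using (_Respects_)
open import Relation.Binary.PropositionalEquality.Core using (_≡_; _≢_)
open import Relation.Binary.Structures using (IsEquivalence)
import Relation.Binary.Construct.On as On
import Algebra.Properties.CommutativeSemigroup as CommutativeSemigroupProperties
open import Relation.Nullary.Negation.Core using (¬_)
open import Relation.Unary
  using (Pred; Universal; _∈_; _≐_; _∩_; ⋃)

private
  variable
    ℓ : Level

-- Sets are setoids, and z ∈ x ⊞ y is a ternary relation.  Carriers,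
-- equalities and subsets all live in one universe ℓ.

record RawHyperfield (ℓ : Level) : Set (suc ℓ) where
  infix  4 _≈_ _≉_
  infixl 6 _⊞_ _⊞ₛ_
  infixl 7 _⊙_ _⊙ₛ_
  field
    Carrier : Set ℓ
    _≈_     : Rel Carrier ℓ
    _⊞_     : Carrier → Carrier → Pred Carrier ℓ
    _⊙_     : Carrier → Carrier → Carrier
    0#      : Carrier
    1#      : Carrier

  _≉_ : Rel Carrier ℓ
  x ≉ y = ¬ (x ≈ y)

  ⟦_⟧ : Carrier → Pred Carrier ℓ
  ⟦ x ⟧ = λ z → z ≈ x

  _⊞ₛ_ : Pred Carrier ℓ → Pred Carrier ℓ → Pred Carrier ℓ
  A ⊞ₛ B = λ z → ∃[ a ] ∃[ b ] a ∈ A × b ∈ B × z ∈ a ⊞ b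

  _⊙ₛ_ : Carrier → Pred Carrier ℓ → Pred Carrier ℓ
  a ⊙ₛ B = λ z → ∃[ b ] b ∈ B × z ≈ a ⊙ b

  NonZero : Pred Carrier ℓ
  NonZero x = x ≉ 0#

  Carrier* : Set ℓ
  Carrier* = ∃ NonZero

  _≈*_ : Rel Carrier* ℓ
  x ≈* y = proj₁ x ≈ proj₁ y

record IsHyperfield (R : RawHyperfield ℓ) : Set ℓ where
  open RawHyperfield R
  field
    isEquivalence : IsEquivalence _≈_
    ⊞-resp-≈      : ∀ {x x′ y y′ z z′} → x ≈ x′ → y ≈ y′ → z ≈ z′ →
                    z ∈ x ⊞ y → z′ ∈ x′ ⊞ y′
    0≉1           : 0# ≉ 1#

    ⊞-nonempty    : ∀ x y → ∃[ z ] z ∈ x ⊞ y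
    ⊞-comm        : ∀ x y → x ⊞ y ≐ y ⊞ x
    ⊞-assoc       : ∀ x y z → (x ⊞ y) ⊞ₛ ⟦ z ⟧ ≐ ⟦ x ⟧ ⊞ₛ (y ⊞ z)
    ⊞-identityˡ   : ∀ x → 0# ⊞ x ≐ ⟦ x ⟧
    ⊞-inverse     : ∀ x → ∃! _≈_ (λ y → 0# ∈ x ⊞ y)

  infix 8 -_
  -_ : Carrier → Carrier
  - x = proj₁ (⊞-inverse x)

  field
    ⊞-reversible          : ∀ x y z → (x ∈ y ⊞ z) ⇔ (z ∈ x ⊞ (- y))

    ⊙-isCommutativeMonoid : IsCommutativeMonoid _≈_ _⊙_ 1#
    ⊙-zeroˡ               : ∀ x → 0# ⊙ x ≈ 0#
    ⊙-distribˡ-⊞          : ∀ a x y → a ⊙ₛ (x ⊞ y) ≐ (a ⊙ x) ⊞ (a ⊙ y)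

    ⊙-nonZero             : ∀ {x y} → NonZero x → NonZero y → NonZero (x ⊙ y)

  1≉0 : NonZero 1#
  1≉0 = 0≉1 ∘ IsEquivalence.sym isEquivalence

  _⊙*_ : Carrier* → Carrier* → Carrier*
  (x , x≉0) ⊙* (y , y≉0) = x ⊙ y , ⊙-nonZero x≉0 y≉0

  1* : Carrier*
  1* = 1# , 1≉0

  field
    _⁻¹       : Carrier* → Carrier*
    ⊙-isGroup : IsGroup _≈*_ _⊙*_ 1* _⁻¹

record Hyperfield (ℓ : Level) : Set (suc ℓ) where
  field
    rawHyperfield : RawHyperfield ℓ
    isHyperfield  : IsHyperfield rawHyperfield

  open RawHyperfield rawHyperfield public
  open IsHyperfield isHyperfield public

  setoid : Setoid ℓ ℓ
  setoid = record { isEquivalence = isEquivalence }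

  *-setoid : Setoid ℓ ℓ
  *-setoid = On.setoid setoid (proj₁ {B = NonZero})

  -- The iterated hypersum; the empty one is {0}.
  ⨁ : ∀ {m} → (Fin m → Carrier) → Pred Carrier ℓ
  ⨁ {zero}    f = ⟦ 0# ⟧
  ⨁ {ℕ.suc m} f = ⟦ f fzero ⟧ ⊞ₛ ⨁ (f ∘ fsuc)

  [-1]^_ : ℕ → Carrier
  [-1]^ zero    = 1#
  [-1]^ ℕ.suc k = (- 1#) ⊙ ([-1]^ k)

  ⨀ : ∀ {m} → Vec Carrier m → Carrier
  ⨀ = Vec.foldr _ _⊙_ 1#

-- The induced hyperoperation is (x , y) ↦ (x ⊞ y) ∩ Member.
record SubHyperfield (H : Hyperfield ℓ) : Set (suc ℓ) where
  private module H = Hyperfield H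
  field
    Member   : Pred H.Carrier ℓ
    resp-≈   : Member Respects H._≈_
    ⊙-closed : ∀ {x y} → x ∈ Member → y ∈ Member → (x H.⊙ y) ∈ Member
    0∈       : H.0# ∈ Member
    1∈       : H.1# ∈ Member

  induced : RawHyperfield ℓ
  induced = record
    { Carrier = ∃ Member
    ; _≈_     = λ x y → proj₁ x H.≈ proj₁ y
    ; _⊞_     = λ x y z → proj₁ z ∈ proj₁ x H.⊞ proj₁ y
    ; _⊙_     = λ x y → proj₁ x H.⊙ proj₁ y , ⊙-closed (proj₂ x) (proj₂ y)
    ; 0#      = H.0# , 0∈
    ; 1#      = H.1# , 1∈
    }

  field
    induced-isHyperfield : IsHyperfield induced

  hyperfield : Hyperfield ℓ
  hyperfield = record
    { rawHyperfield = induced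
    ; isHyperfield  = induced-isHyperfield
    }

  inclusion : Hyperfield.Carrier hyperfield → H.Carrier
  inclusion = proj₁

record Topology (S : Setoid ℓ ℓ) : Set (suc (suc ℓ)) where
  open Setoid S
  field
    IsOpen         : Pred (Pred Carrier ℓ) (suc ℓ)
    open-resp-≈    : ∀ {U} → IsOpen U → U Respects _≈_
    open-resp-≐    : ∀ {U V} → U ≐ V → IsOpen U → IsOpen V
    open-universal : ∀ {U} → Universal U → IsOpen U
    open-∩         : ∀ {U V} → IsOpen U → IsOpen V → IsOpen (U ∩ V)
    open-⋃         : ∀ (I : Set ℓ) {U : I → Pred Carrier ℓ} →
                     (∀ i → IsOpen (U i)) → IsOpen (⋃ I U)

private
  full : {A : Set ℓ} → Pred A ℓ
  full _ = Level.Lift _ ⊤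

Continuous : {S₁ S₂ : Setoid ℓ ℓ} → Topology S₁ → Topology S₂ →
             (Setoid.Carrier S₁ → Setoid.Carrier S₂) → Set (suc ℓ)
Continuous τ₁ τ₂ f = ∀ {U} → Topology.IsOpen τ₂ U → Topology.IsOpen τ₁ (U ∘ f)

subspaceSetoid : (S : Setoid ℓ ℓ) → Pred (Setoid.Carrier S) ℓ → Setoid ℓ ℓ
subspaceSetoid S P = On.setoid S (proj₁ {B = P})

subspaceTopology : {S : Setoid ℓ ℓ} → Topology S →
                   (P : Pred (Setoid.Carrier S) ℓ) →
                   Topology (subspaceSetoid S P)
subspaceTopology τ P = record
  { IsOpen         = λ U → ∃[ V ] IsOpen V × U ≐ (V ∘ proj₁)
  ; open-resp-≈    = λ (V , oV , U⊆V , V⊆U) x≈y x∈U →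
                       V⊆U (open-resp-≈ oV x≈y (U⊆V x∈U))
  ; open-resp-≐    = λ (U⊆U′ , U′⊆U) (V , oV , U⊆V , V⊆U) →
                       V , oV , (λ x∈U′ → U⊆V (U′⊆U x∈U′))
                              , (λ x∈V → U⊆U′ (V⊆U x∈V))
  ; open-universal = λ u → full , open-universal (λ _ → _)
                         , (λ _ → _) , (λ {x} _ → u x)
  ; open-∩         = λ (V , oV , U⊆V , V⊆U) (V′ , oV′ , U′⊆V′ , V′⊆U′) →
                       V ∩ V′ , open-∩ oV oV′
                       , (λ (p , q) → U⊆V p , U′⊆V′ q)
                       , (λ (p , q) → V⊆U p , V′⊆U′ q)
  ; open-⋃         = λ I o → ⋃ I (proj₁ ∘ o) , open-⋃ I (proj₁ ∘ proj₂ ∘ o)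
                       , (λ (i , p) → i , proj₁ (proj₂ (proj₂ (o i))) p)
                       , (λ (i , p) → i , proj₂ (proj₂ (proj₂ (o i))) p)
  }
  where
  open Topology τ
productTopology : {S₁ S₂ : Setoid ℓ ℓ} → Topology S₁ → Topology S₂ →
                  Topology (S₁ ×ₛ S₂)
productTopology τ₁ τ₂ = record
  { IsOpen         = λ U → ∀ {x y} → (x , y) ∈ U →
                       ∃[ V ] ∃[ W ] τ₁.IsOpen V × τ₂.IsOpen W × x ∈ V × y ∈ W ×
                       (∀ {x′ y′} → x′ ∈ V → y′ ∈ W → (x′ , y′) ∈ U)
  ; open-resp-≈    = λ oU (x≈x′ , y≈y′) p →
                       let V , W , oV , oW , x∈V , y∈W , V×W⊆U = oU p in
                       V×W⊆U (τ₁.open-resp-≈ oV x≈x′ x∈V)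
                             (τ₂.open-resp-≈ oW y≈y′ y∈W)
  ; open-resp-≐    = λ (U⊆U′ , U′⊆U) oU p →
                       let V , W , oV , oW , x∈V , y∈W , V×W⊆U = oU (U′⊆U p) in
                       V , W , oV , oW , x∈V , y∈W , λ v w → U⊆U′ (V×W⊆U v w)
  ; open-universal = λ u _ →
                       full , full
                       , τ₁.open-universal _ , τ₂.open-universal _
                       , _ , _ , λ _ _ → u _
  ; open-∩         = λ oU oU′ (p , p′) →
                       let V , W , oV , oW , x∈V , y∈W , V×W⊆U = oU p
                           V′ , W′ , oV′ , oW′ , x∈V′ , y∈W′ , V′×W′⊆U′ = oU′ p′
                       in V ∩ V′ , W ∩ W′ , τ₁.open-∩ oV oV′ , τ₂.open-∩ oW oW′
                          , (x∈V , x∈V′) , (y∈W , y∈W′)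
                          , λ (v , v′) (w , w′) → V×W⊆U v w , V′×W′⊆U′ v′ w′
  ; open-⋃         = λ I o (i , p) →
                       let V , W , oV , oW , x∈V , y∈W , V×W⊆U = o i p in
                       V , W , oV , oW , x∈V , y∈W , λ v w → i , V×W⊆U v w
  }
  where
  module τ₁ = Topology τ₁
  module τ₂ = Topology τ₂

powerSetoid : Set → Setoid ℓ ℓ → Setoid ℓ ℓ
powerSetoid A S = record
  { Carrier       = A → Carrier
  ; _≈_           = λ f g → ∀ a → f a ≈ g a
  ; isEquivalence = record
    { refl  = λ _ → refl
    ; sym   = λ p a → sym (p a)
    ; trans = λ p q a → trans (p a) (q a)
    }
  }
  where open Setoid S

-- A basic neighbourhood constrains only the finitely many coordinates in
-- the list as.
powerTopology : (A : Set) {S : Setoid ℓ ℓ} → Topology S →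
                Topology (powerSetoid A S)
powerTopology A {S} τ = record
  { IsOpen         = λ U → ∀ {f} → f ∈ U → BasicNbhd f U
  ; open-resp-≈    = λ oU f≈g p →
                       let as , V , oV , f∈V , V⊆U = oU p in
                       V⊆U (All.universal (λ a → open-resp-≈ (oV a) (f≈g a) (f∈V a)) as)
  ; open-resp-≐    = λ (U⊆U′ , U′⊆U) oU p →
                       let as , V , oV , f∈V , V⊆U = oU (U′⊆U p) in
                       as , V , oV , f∈V , λ g∈V → U⊆U′ (V⊆U g∈V)
  ; open-universal = λ u _ →
                       [] , (λ _ → full) , (λ _ → open-universal _) , _ , λ _ → u _
  ; open-∩         = λ oU oU′ (p , p′) →
                       let as  , V  , oV  , f∈V  , V⊆U   = oU p
                           as′ , V′ , oV′ , f∈V′ , V′⊆U′ = oU′ p′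
                       in as ++ as′ , (λ a → V a ∩ V′ a)
                          , (λ a → open-∩ (oV a) (oV′ a))
                          , (λ a → f∈V a , f∈V′ a)
                          , λ g∈ → V⊆U   (All.map proj₁ (++⁻ˡ as g∈))
                                 , V′⊆U′ (All.map proj₂ (++⁻ʳ as g∈))
  ; open-⋃         = λ I o (i , p) →
                       let as , V , oV , f∈V , V⊆U = o i p in
                       as , V , oV , f∈V , λ g∈V → i , V⊆U g∈V
  }
  where
  open Setoid S using (Carrier)
  open Topology τ

  BasicNbhd : (A → Carrier) → Pred (A → Carrier) _ → Set _
  BasicNbhd f U =
    Σ[ as ∈ List A ] Σ[ V ∈ (A → Pred Carrier _) ]
      (∀ a → IsOpen (V a)) × (∀ a → f a ∈ V a) ×
      (∀ {g} → All (λ a → g a ∈ V a) as → g ∈ U)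

quotientTopology : (S : Setoid ℓ ℓ) → Topology S →
                   (_∼_ : Rel (Setoid.Carrier S) ℓ) →
                   (isEq : IsEquivalence _∼_) →
                   Topology (record { isEquivalence = isEq })
quotientTopology S τ _∼_ isEq = record
  { IsOpen         = λ U → U Respects _∼_ × IsOpen U
  ; open-resp-≈    = proj₁
  ; open-resp-≐    = λ (U⊆V , V⊆U) (r , o) →
                       (λ x∼y x∈V → U⊆V (r x∼y (V⊆U x∈V)))
                       , open-resp-≐ (U⊆V , V⊆U) o
  ; open-universal = λ u → (λ _ _ → u _) , open-universal u
  ; open-∩         = λ (r , o) (r′ , o′) →
                       (λ x∼y (p , p′) → r x∼y p , r′ x∼y p′) , open-∩ o o′
  ; open-⋃         = λ I o → (λ x∼y (i , p) → i , proj₁ (o i) x∼y p)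
                       , open-⋃ I (proj₂ ∘ o)
  }
  where open Topology τ

record HyperfieldTopology (H : Hyperfield ℓ) : Set (suc (suc ℓ)) where
  open Hyperfield H
  field
    topology : Topology setoid

  *-topology : Topology *-setoid
  *-topology = subspaceTopology topology NonZero

  field
    nonZero-open  : Topology.IsOpen topology NonZero
    ⊙-continuous  : Continuous (productTopology topology topology) topology
                      (λ (x , y) → x ⊙ y)
    ⁻¹-continuous : Continuous *-topology *-topology _⁻¹

-- The set of bases is a subset of a finite set, hence Boolean-valued.
record Matroid (n : ℕ) : Set where
  field
    isBasis : Subset n → Bool

  IsBasis : Subset n → Set
  IsBasis B = T (isBasis B)

  field
    nonempty : ∃ IsBasis
    exchange : ∀ {B₁ B₂ x} → IsBasis B₁ → IsBasis B₂ →
               x Subset.∈ B₁ → x Subset.∉ B₂ →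
               ∃[ y ] y Subset.∈ B₂ × y Subset.∉ B₁ × IsBasis ((B₁ - x) ∪ ⁅ y ⁆)

  -- All bases are equicardinal, so the choice of basis is immaterial.
  rank : ℕ
  rank = ∣ proj₁ nonempty ∣

underlyingSet : ∀ {n m} → Vec (Fin n) m → Subset n
underlyingSet = Vec.foldr _ (λ e I → ⁅ e ⁆ ∪ I) Subset.⊥

swap : ∀ {A : Set} {m} → Vec A m → Fin m → Fin m → Vec A m
swap xs i j = (xs [ i ]≔ lookup xs j) [ j ]≔ lookup xs i

data Strength : Set where
  weak strong : Strength

module _ (H : Hyperfield ℓ) {n : ℕ} where
  open Hyperfield H

  -- The transposition rule is the sign rule for arbitrary permutations.
  record IsAlternating {d} (φ : Vec (Fin n) d → Carrier) : Set ℓ where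
    field
      antisymmetric : ∀ xs {i j} → i ≢ j → φ (swap xs i j) ≈ - φ xs
      vanishing     : ∀ xs {i j} → i ≢ j → lookup xs i ≡ lookup xs j → φ xs ≈ 0#

  -- I and J are given by injective enumerations xs and ys.  There is no J
  -- of cardinality d - 1 when d = 0.  The index k starts at 0, whence suc.
  GPRelations : ∀ d → (Subset n → Subset n → Set) →
                (Vec (Fin n) d → Carrier) → Set ℓ
  GPRelations zero      _          φ = Level.Lift _ ⊤
  GPRelations (ℕ.suc d) Admissible φ =
    ∀ (xs : Vec (Fin n) (2 ℕ.+ d)) (ys : Vec (Fin n) d) →
    Unique xs → Unique ys → Admissible (underlyingSet xs) (underlyingSet ys) →
    0# ∈ ⨁ (λ k → ([-1]^ ℕ.suc (toℕ k)) ⊙ φ (removeAt xs k) ⊙ φ (lookup xs k ∷ ys))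

  -- The support of φ is the set of bases of M.  Constructively,
  -- off-support does not follow from support.
  record HasUnderlyingMatroid {d} (φ : Vec (Fin n) d → Carrier)
                              (M : Matroid n) : Set ℓ where
    open Matroid M
    field
      support     : ∀ xs → (φ xs ≉ 0#) ⇔ IsBasis (underlyingSet xs)
      off-support : ∀ xs → ¬ IsBasis (underlyingSet xs) → φ xs ≈ 0#

  record IsStrongGP {d} (φ : Vec (Fin n) d → Carrier) : Set ℓ where
    field
      nonzero     : ∃[ xs ] φ xs ≉ 0#
      alternating : IsAlternating φ
      relations   : GPRelations d (λ _ _ → ⊤) φ

  record IsWeakGP {d} (φ : Vec (Fin n) d → Carrier) : Set ℓ where
    field
      nonzero     : ∃[ xs ] φ xs ≉ 0#
      alternating : IsAlternating φ
      matroid     : ∃[ N ] HasUnderlyingMatroid φ N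
      relations   : GPRelations d (λ I J → ∣ I ─ J ∣ ℕ.≤ 3) φ

  IsGP : Strength → ∀ {d} → (Vec (Fin n) d → Carrier) → Set ℓ
  IsGP weak   = IsWeakGP
  IsGP strong = IsStrongGP

module Space (k : Strength) (H : Hyperfield ℓ) {n : ℕ} (M : Matroid n) where
  open Hyperfield H
  open Matroid M using (rank)

  Function : Set ℓ
  Function = Vec (Fin n) rank → Carrier

  GPSetoid : Setoid ℓ ℓ
  GPSetoid = subspaceSetoid (powerSetoid (Vec (Fin n) rank) setoid)
                            (λ φ → IsGP H k φ × HasUnderlyingMatroid H φ M)

  GP : Set ℓ
  GP = Setoid.Carrier GPSetoid

  infix 4 _∼_ _≋_

  _∼_ : Rel Function ℓ
  φ ∼ ψ = ∃[ a ] NonZero a × (∀ xs → φ xs ≈ a ⊙ ψ xs)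

  rescale : (Fin n → Carrier*) → Function → Function
  rescale h φ xs = ⨀ (Vec.map (proj₁ ∘ h) xs) ⊙ φ xs

  -- The class of φ is that of a rescaling of ψ; this is already an
  -- equivalence relation.
  _≋_ : Rel Function ℓ
  φ ≋ ψ = ∃[ h ] φ ∼ rescale h ψ

  private
    ⊙-commutativeSemigroup : CommutativeSemigroup ℓ ℓ
    ⊙-commutativeSemigroup = record
      { isCommutativeSemigroup =
          IsCommutativeMonoid.isCommutativeSemigroup ⊙-isCommutativeMonoid }

    module G = IsGroup ⊙-isGroup

    open IsCommutativeMonoid ⊙-isCommutativeMonoid
      using (refl; sym; trans; ∙-cong; ∙-congˡ; ∙-congʳ; assoc; identityˡ)
    open CommutativeSemigroupProperties ⊙-commutativeSemigroup
      using (interchange; x∙yz≈y∙xz)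

    act : (Fin n → Carrier*) → ∀ {m} → Vec (Fin n) m → Carrier
    act h xs = ⨀ (Vec.map (proj₁ ∘ h) xs)

    act-1 : ∀ {m} (xs : Vec (Fin n) m) → act (λ _ → 1*) xs ≈ 1#
    act-1 []       = refl
    act-1 (x ∷ xs) = trans (identityˡ _) (act-1 xs)

    act-⊙ : ∀ g h {m} (xs : Vec (Fin n) m) →
            act (λ e → g e ⊙* h e) xs ≈ act g xs ⊙ act h xs
    act-⊙ g h []       = sym (identityˡ 1#)
    act-⊙ g h (x ∷ xs) =
      trans (∙-congˡ (act-⊙ g h xs)) (interchange _ _ _ _)

    act-cong : ∀ g h → (∀ e → g e ≈* h e) →
               ∀ {m} (xs : Vec (Fin n) m) → act g xs ≈ act h xs
    act-cong g h p []       = refl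
    act-cong g h p (x ∷ xs) = ∙-cong (p x) (act-cong g h p xs)

    act-inverse : ∀ h {m} (xs : Vec (Fin n) m) →
                  act (_⁻¹ ∘ h) xs ⊙ act h xs ≈ 1#
    act-inverse h xs =
      trans (sym (act-⊙ (_⁻¹ ∘ h) h xs))
            (trans (act-cong (λ e → (h e ⁻¹) ⊙* h e) (λ _ → 1*) (G.inverseˡ ∘ h) xs)
                   (act-1 xs))

    cancel : ∀ {b a x y} → b ⊙ a ≈ 1# → x ≈ a ⊙ y → y ≈ b ⊙ x
    cancel ba≈1 x≈ay =
      sym (trans (∙-congˡ x≈ay)
          (trans (sym (assoc _ _ _)) (trans (∙-congʳ ba≈1) (identityˡ _))))

    ∼-refl : ∀ {φ} → φ ∼ φ
    ∼-refl = 1# , 1≉0 , λ _ → sym (identityˡ _)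

    ∼-sym : ∀ {φ ψ} → φ ∼ ψ → ψ ∼ φ
    ∼-sym (a , a≉0 , p) =
      let a⁻¹ , a⁻¹≉0 = (a , a≉0) ⁻¹ in
      a⁻¹ , a⁻¹≉0 , λ xs → cancel (G.inverseˡ (a , a≉0)) (p xs)

    ∼-trans : ∀ {φ ψ χ} → φ ∼ ψ → ψ ∼ χ → φ ∼ χ
    ∼-trans (a , a≉0 , p) (b , b≉0 , q) =
      a ⊙ b , ⊙-nonZero a≉0 b≉0 ,
      λ xs → trans (p xs) (trans (∙-congˡ (q xs)) (sym (assoc _ _ _)))

    ≋-refl : ∀ {φ} → φ ≋ φ
    ≋-refl = (λ _ → 1*) , 1# , 1≉0 ,
      λ xs → sym (trans (identityˡ _) (trans (∙-congʳ (act-1 xs)) (identityˡ _)))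

    ≋-sym : ∀ {φ ψ} → φ ≋ ψ → ψ ≋ φ
    ≋-sym (h , p) = _⁻¹ ∘ h ,
      let a , a≉0 , q = ∼-sym p in
      a , a≉0 , λ xs → trans (cancel (act-inverse h xs) (sym (q xs))) (x∙yz≈y∙xz _ _ _)

    ≋-trans : ∀ {φ ψ χ} → φ ≋ ψ → ψ ≋ χ → φ ≋ χ
    ≋-trans (g , a , a≉0 , p) (h , b , b≉0 , q) =
      (λ e → g e ⊙* h e) , a ⊙ b , ⊙-nonZero a≉0 b≉0 , λ xs →
      trans (p xs) (trans (∙-congˡ (∙-congˡ (q xs)))
      (trans (∙-congˡ (x∙yz≈y∙xz _ _ _)) (trans (sym (assoc _ _ _))
      (∙-congˡ (trans (sym (assoc _ _ _)) (∙-congʳ (sym (act-⊙ g h xs))))))))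

  ∼-isEquivalence : IsEquivalence {A = GP} (λ φ ψ → proj₁ φ ∼ proj₁ ψ)
  ∼-isEquivalence = record { refl = ∼-refl ; sym = ∼-sym ; trans = ∼-trans }

  ≋-isEquivalence : IsEquivalence {A = GP} (λ φ ψ → proj₁ φ ≋ proj₁ ψ)
  ≋-isEquivalence = record { refl = ≋-refl ; sym = ≋-sym ; trans = ≋-trans }

  𝓜 : Setoid ℓ ℓ
  𝓜 = record { isEquivalence = ∼-isEquivalence }

  𝓡 : Setoid ℓ ℓ
  𝓡 = record { isEquivalence = ≋-isEquivalence }

  module _ (τ : HyperfieldTopology H) where
    open HyperfieldTopology τ using (topology)

    𝓜-topology : Topology 𝓜
    𝓜-topology = quotientTopology GPSetoid
      (subspaceTopology (powerTopology _ topology) _) _ ∼-isEquivalence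

    𝓡-topology : Topology 𝓡
    𝓡-topology = quotientTopology 𝓜 𝓜-topology _ ≋-isEquivalence

{-# OPTIONS --safe #-}
-- Both maps are composition with the inclusion H₁ → H₂.  Injectivity on 𝓜:
-- a scalar relating two H₁-valued functions is a quotient of two of their
-- nonzero values.  Injectivity on 𝓡: let φ = a h ψ with a and h valued in H₂*.
-- Comparing the values at bases B and B - x + y shows h x / h y ∈ H₁*.  Choose
-- rep x in the class of x for the equivalence relation generated by such
-- exchanges, and write h x = h′ x h (rep x) with h′ x ∈ H₁*.  By basis exchange
-- all bases meet a class equally often, so the product of h ∘ rep over a basis
-- is a constant K, and φ = (a K) h′ ψ; now a K ∈ H₁* as before.
module Submission where

open import Level using (Level)
open import Data.Nat.Base using (ℕ)
open import Data.Product.Base using (Σ-syntax; _×_)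
open import Function.Bundles using (Injection)
open import Defs

open import Algebra.Bundles using (CommutativeMonoid)
open import Algebra.Structures using (IsGroup)
import Algebra.Properties.CommutativeSemigroup as CommutativeSemigroupProperties
import Algebra.Solver.CommutativeMonoid as CommutativeMonoidSolver
open import Data.Bool.Base using (if_then_else_)
open import Data.Fin.Base using (Fin; zero; suc; toℕ)
open import Data.Fin.Properties using (_≟_; any?)
open import Data.Fin.Subset using (Subset; inside; outside; _∈_; _∉_; _⊂_; ⊥; ⁅_⁆; _∪_; _─_; _-_; ∣_∣)
open import Data.Fin.Subset.Properties
open import Data.List.Base using (List; []; _∷_; allFin; cartesianProduct; filter)
open import Data.List.Membership.Propositional.Properties
  using (∈-allFin; ∈-cartesianProduct⁺; ∈-filter⁺)
open import Data.List.Relation.Unary.All as All using (All; []; _∷_)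
open import Data.List.Relation.Unary.All.Properties using (all-filter)
open import Data.Nat.Base using (_<_; zero; suc)
open import Data.Nat.Induction using (<-wellFounded)
open import Data.Product.Base using (∃; _,_; proj₁; proj₂; uncurry)
open import Data.Sum.Base using (inj₁; inj₂)
open import Data.Vec.Base as Vec using (Vec; []; _∷_; lookup; _[_]≔_; here; there; removeAt)
open import Data.Vec.Properties using (tabulate∘lookup; lookup∘update; lookup∘update′)
open import Data.Vec.Relation.Unary.AllPairs using (_∷_)
import Data.Vec.Relation.Unary.All.Properties as VecAll
open import Data.Vec.Relation.Unary.Unique.Propositional using (Unique)
open import Data.Vec.Relation.Unary.Unique.Propositional.Properties
  using (lookup-injective; tabulate⁺)
open import Function.Base using (_∘_)
open import Function.Bundles using (module Equivalence)
open import Induction.WellFounded using (Acc; acc)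
open import Relation.Binary.Core using (Rel)
open import Relation.Binary.PropositionalEquality.Core
  using (_≡_; _≢_; refl; sym; cong; subst)
open import Relation.Binary.Structures using (IsEquivalence)
import Relation.Binary.Reasoning.Setoid as SetoidReasoning
open import Relation.Nullary.Decidable using (Dec; yes; no; does; _×-dec_; T?; map′)
open import Relation.Nullary.Negation using (contradiction)
open import Relation.Unary using (Pred; Decidable)

private
  variable
    ℓ ℓ′ : Level
    n m d : ℕ

-- Underlying sets of vectors.

x∈p─q⇒x∉q : ∀ {x} (p q : Subset n) → x ∈ p ─ q → x ∉ q
x∈p─q⇒x∉q (_ ∷ p) (inside  ∷ q) (there x∈p─q) (there x∈q) = x∈p─q⇒x∉q p q x∈p─q x∈q
x∈p─q⇒x∉q (_ ∷ p) (outside ∷ q) (there x∈p─q) (there x∈q) = x∈p─q⇒x∉q p q x∈p─q x∈q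

∈-underlyingSet⁺ : ∀ (xs : Vec (Fin n) m) i → lookup xs i ∈ underlyingSet xs
∈-underlyingSet⁺ (x ∷ xs) zero    = x∈p∪q⁺ (inj₁ (x∈⁅x⁆ x))
∈-underlyingSet⁺ (x ∷ xs) (suc i) = x∈p∪q⁺ (inj₂ (∈-underlyingSet⁺ xs i))

∈-underlyingSet⁻ : ∀ (xs : Vec (Fin n) m) {x} → x ∈ underlyingSet xs → ∃ λ i → lookup xs i ≡ x
∈-underlyingSet⁻ []       x∈ = contradiction x∈ ∉⊥
∈-underlyingSet⁻ (y ∷ xs) x∈ with x∈p∪q⁻ ⁅ y ⁆ (underlyingSet xs) x∈
... | inj₁ x∈⁅y⁆ = zero , sym (x∈⁅y⁆⇒x≡y y x∈⁅y⁆)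
... | inj₂ x∈xs  = let i , eq = ∈-underlyingSet⁻ xs x∈xs in suc i , eq

-- Uniqueness ensures that the replaced entry does not survive at another position, so overwriting
-- one coordinate is exactly the set operation in `Matroid.exchange`.
underlyingSet-update : ∀ {xs : Vec (Fin n) m} → Unique xs → ∀ i y →
  underlyingSet (xs [ i ]≔ y) ≡ (underlyingSet xs - lookup xs i) ∪ ⁅ y ⁆
underlyingSet-update {xs = xs} xs! i y = ⊆-antisym to from
  where
  to : ∀ {z} → z ∈ underlyingSet (xs [ i ]≔ y) → z ∈ (underlyingSet xs - lookup xs i) ∪ ⁅ y ⁆
  to z∈ with j , refl ← ∈-underlyingSet⁻ (xs [ i ]≔ y) z∈ | j ≟ i
  ... | yes refl rewrite lookup∘update i xs y = x∈p∪q⁺ (inj₂ (x∈⁅x⁆ y))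
  ... | no j≢i rewrite lookup∘update′ j≢i xs y =
    x∈p∪q⁺ (inj₁ (x∈p∧x≢y⇒x∈p-y (∈-underlyingSet⁺ xs j) (j≢i ∘ lookup-injective xs! j i)))

  from : ∀ {z} → z ∈ (underlyingSet xs - lookup xs i) ∪ ⁅ y ⁆ → z ∈ underlyingSet (xs [ i ]≔ y)
  from z∈ with x∈p∪q⁻ (underlyingSet xs - lookup xs i) ⁅ y ⁆ z∈
  ... | inj₂ z∈⁅y⁆ with refl ← x∈⁅y⁆⇒x≡y y z∈⁅y⁆ =
    subst (_∈ underlyingSet (xs [ i ]≔ y)) (lookup∘update i xs y) (∈-underlyingSet⁺ (xs [ i ]≔ y) i)
  ... | inj₁ z∈xs-x with j , refl ← ∈-underlyingSet⁻ xs (p─q⊆p (underlyingSet xs) ⁅ lookup xs i ⁆ z∈xs-x) =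
    subst (_∈ underlyingSet (xs [ i ]≔ y)) (lookup∘update′ j≢i xs y) (∈-underlyingSet⁺ (xs [ i ]≔ y) j)
    where
    j≢i : j ≢ i
    j≢i refl = x∈p─q⇒x∉q (underlyingSet xs) _ z∈xs-x (x∈⁅x⁆ _)

-- Finite search and class representatives.

anyVec? : ∀ {P : Pred (Vec (Fin n) m) ℓ} → Decidable P → Dec (∃ P)
anyVec? {m = zero}  P? = map′ ([] ,_) (λ { ([] , p) → p }) (P? [])
anyVec? {m = suc m} P? =
  map′ (λ (x , xs , p) → x ∷ xs , p) (λ { (x ∷ xs , p) → x , xs , p })
       (any? λ x → anyVec? (P? ∘ (x ∷_)))

module _ {_~_ : Rel (Fin n) ℓ} (~-isEquivalence : IsEquivalence _~_) where
  private module ~ = IsEquivalence ~-isEquivalence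

  -- `_~_` is not assumed decidable, so representatives are only made to agree along a given finite
  -- list of related pairs. The pairs are added one at a time, each merging two classes.
  representatives : ∀ {es} → All (uncurry _~_) es →
    ∃ λ (rep : Fin n → Fin n) → (∀ x → x ~ rep x) × All (λ (x , y) → rep x ≡ rep y) es
  representatives [] = (λ x → x) , (λ _ → ~.refl) , []
  representatives (_∷_ {x = u , v} u~v es~) with rep , ~rep , reps ← representatives es~ =
    merge ∘ rep , ~merge , u≡v ∷ All.map (cong merge) reps
    where
    merge : Fin n → Fin n
    merge x = if does (x ≟ rep v) then rep u else x

    ~merge : ∀ x → x ~ merge (rep x)
    ~merge x with rep x ≟ rep v
    ... | no _   = ~rep x
    -- The chain is `x ~ rep x ≡ rep v ~ v ~ u ~ rep u`.
    ... | yes eq = ~.trans (~rep x) (~.trans (~.reflexive eq)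
                   (~.trans (~.sym (~rep v)) (~.trans (~.sym u~v) (~rep u))))

    u≡v : merge (rep u) ≡ merge (rep v)
    -- Both sides equal `rep u`: the left one under either outcome of its test, the right one
    -- because its test compares `rep v` with itself.
    u≡v with rep u ≟ rep v | rep v ≟ rep v
    ... | _     | no v≢v = contradiction refl v≢v
    ... | yes _ | yes _  = refl
    ... | no _  | yes _  = refl

  -- The decidable relation `R` has finitely many pairs; filtering them out of all pairs gives the
  -- list along which representatives are merged.
  classRepresentatives : ∀ {R : Rel (Fin n) ℓ′} → (∀ x y → Dec (R x y)) →
    (∀ {x y} → R x y → x ~ y) →
    ∃ λ (rep : Fin n → Fin n) → (∀ x → x ~ rep x) × (∀ {x y} → R x y → rep x ≡ rep y)
  classRepresentatives {R = R} R? R⇒~ =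
    let rep , ~rep , reps = representatives (All.map R⇒~ (all-filter R?′ pairs))
    in rep , ~rep , λ {x} {y} r →
       All.lookup reps (∈-filter⁺ R?′ (∈-cartesianProduct⁺ (∈-allFin x) (∈-allFin y)) r)
    where
    pairs : List (Fin n × Fin n)
    pairs = cartesianProduct (allFin n) (allFin n)

    R?′ : Decidable (uncurry R)
    R?′ (x , y) = R? x y

-- Products over vectors and over subsets.

module Products {c} (𝓖 : CommutativeMonoid c ℓ) where
  open CommutativeMonoid 𝓖 renaming (refl to ≈-refl; sym to ≈-sym; trans to ≈-trans)
  open CommutativeSemigroupProperties commutativeSemigroup using (interchange; x∙yz≈y∙xz; xy∙z≈zy∙x)

  ∏ : (Fin n → Carrier) → Vec (Fin n) m → Carrier
  ∏ g xs = Vec.foldr _ _∙_ ε (Vec.map g xs)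

  ∏-∙ : ∀ {f g h : Fin n → Carrier} → (∀ x → f x ≈ g x ∙ h x) →
        (xs : Vec (Fin n) m) → ∏ f xs ≈ ∏ g xs ∙ ∏ h xs
  ∏-∙ f≈gh []       = ≈-sym (identityˡ ε)
  ∏-∙ f≈gh (x ∷ xs) = ≈-trans (∙-cong (f≈gh x) (∏-∙ f≈gh xs)) (interchange _ _ _ _)

  -- Cross-multiplied, since a monoid has no division.
  ∏-update : ∀ (g : Fin n → Carrier) (xs : Vec (Fin n) m) i y →
             ∏ g (xs [ i ]≔ y) ∙ g (lookup xs i) ≈ ∏ g xs ∙ g y
  ∏-update g (x ∷ xs) zero    y = xy∙z≈zy∙x _ _ _
  ∏-update g (x ∷ xs) (suc i) y =
    ≈-trans (assoc _ _ _) (≈-trans (∙-congˡ (∏-update g xs i y)) (≈-sym (assoc _ _ _)))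

  ∏ₛ : (Fin n → Carrier) → Subset n → Carrier
  ∏ₛ g []            = ε
  ∏ₛ g (inside  ∷ p) = g zero ∙ ∏ₛ (g ∘ suc) p
  ∏ₛ g (outside ∷ p) = ∏ₛ (g ∘ suc) p

  ∏ₛ-⊥ : ∀ (g : Fin n → Carrier) → ∏ₛ g ⊥ ≈ ε
  ∏ₛ-⊥ {n = zero}  g = ≈-refl
  ∏ₛ-⊥ {n = suc _} g = ∏ₛ-⊥ (g ∘ suc)

  ∏ₛ-insert : ∀ (g : Fin n → Carrier) x p → x ∉ p → ∏ₛ g (⁅ x ⁆ ∪ p) ≈ g x ∙ ∏ₛ g p
  ∏ₛ-insert g zero    (inside  ∷ p) x∉p = contradiction here x∉p
  ∏ₛ-insert g zero    (outside ∷ p) x∉p = reflexive (cong (λ q → g zero ∙ ∏ₛ (g ∘ suc) q) (∪-identityˡ p))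
  ∏ₛ-insert g (suc x) (inside  ∷ p) x∉p =
    ≈-trans (∙-congˡ (∏ₛ-insert (g ∘ suc) x p (x∉p ∘ there))) (x∙yz≈y∙xz _ _ _)
  ∏ₛ-insert g (suc x) (outside ∷ p) x∉p = ∏ₛ-insert (g ∘ suc) x p (x∉p ∘ there)

  -- Makes the product over a repetition-free vector depend on its underlying set alone, so that two
  -- orderings of one basis have the same product.
  ∏≈∏ₛ : ∀ (g : Fin n → Carrier) {xs : Vec (Fin n) m} → Unique xs → ∏ g xs ≈ ∏ₛ g (underlyingSet xs)
  ∏≈∏ₛ g {[]}     _            = ≈-sym (∏ₛ-⊥ g)
  ∏≈∏ₛ g {x ∷ xs} (x≢xs ∷ xs!) =
    ≈-trans (∙-congˡ (∏≈∏ₛ g xs!)) (≈-sym (∏ₛ-insert g x (underlyingSet xs) x∉xs))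
    where
    x∉xs : x ∉ underlyingSet xs
    x∉xs x∈xs with i , eq ← ∈-underlyingSet⁻ xs x∈xs = VecAll.lookup⁺ x≢xs i (sym eq)

-- Basis exchange.

-- The condition on ordered bases holds automatically when d is the rank.
module BasisExchange (M : Matroid n) (d : ℕ)
  (basis⇒unique : ∀ {xs : Vec (Fin n) d} → Matroid.IsBasis M (underlyingSet xs) → Unique xs) where
  open Matroid M

  OrderedBasis : Vec (Fin n) d → Set
  OrderedBasis xs = IsBasis (underlyingSet xs)

  -- Both `B` and `B - x + y` are bases, expressed through ordered bases so that a finite search
  -- decides it. When `d` is the rank, the equivalence classes it generates are the connected
  -- components of `M`.
  Exchangeable : Rel (Fin n) _
  Exchangeable x y = ∃ λ xs → ∃ λ i → lookup xs i ≡ x × OrderedBasis xs × OrderedBasis (xs [ i ]≔ y)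

  exchangeable? : ∀ x y → Dec (Exchangeable x y)
  exchangeable? x y = anyVec? λ xs → any? λ i →
    (lookup xs i ≟ x) ×-dec T? _ ×-dec T? _

  module _ (P : Vec (Fin n) d → Vec (Fin n) d → Set ℓ)
    (P-base : ∀ {xs ys} → OrderedBasis xs → OrderedBasis ys → underlyingSet xs ≡ underlyingSet ys → P xs ys)
    (P-step : ∀ {xs ys i y} → OrderedBasis xs → OrderedBasis (xs [ i ]≔ y) → P (xs [ i ]≔ y) ys → P xs ys) where

    private
      -- Recursion on the number of elements of `xs` outside `ys`: each exchange replaces one of
      -- them by an element of `ys`.
      go : ∀ {xs ys} → OrderedBasis xs → OrderedBasis ys →
           Acc _<_ ∣ underlyingSet xs ─ underlyingSet ys ∣ → P xs ys
      go {xs} {ys} bxs bys (acc rs) with nonempty? (underlyingSet xs ─ underlyingSet ys)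
      ... | no empty = P-base bxs bys (⊆-antisym xs⊆ys ys⊆xs)
        where
        xs⊆ys : ∀ {z} → z ∈ underlyingSet xs → z ∈ underlyingSet ys
        xs⊆ys {z} z∈xs with z ∈? underlyingSet ys
        ... | yes z∈ys = z∈ys
        ... | no z∉ys  = contradiction (z , x∈p∧x∉q⇒x∈p─q z∈xs z∉ys) empty

        ys⊆xs : ∀ {z} → z ∈ underlyingSet ys → z ∈ underlyingSet xs
        ys⊆xs {z} z∈ys with z ∈? underlyingSet xs
        ... | yes z∈xs = z∈xs
        -- Exchanging `z` out of `ys` would produce an element of `xs` outside `ys`.
        ... | no z∉xs  = let _ , w∈xs , w∉ys , _ = exchange bys bxs z∈ys z∉xs in
                         contradiction (xs⊆ys w∈xs) w∉ys
      ... | yes (x , x∈xs─ys)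
          with x∈xs ← p─q⊆p (underlyingSet xs) (underlyingSet ys) x∈xs─ys
             | x∉ys ← x∈p─q⇒x∉q (underlyingSet xs) (underlyingSet ys) x∈xs─ys
          with i , refl ← ∈-underlyingSet⁻ xs x∈xs
             | y , y∈ys , y∉xs , b ← exchange bxs bys x∈xs x∉ys =
        P-step bxs bxs′ (go bxs′ bys (rs (p⊂q⇒∣p∣<∣q∣ xs′─ys⊂xs─ys)))
        where
        xs′≡ : underlyingSet (xs [ i ]≔ y) ≡ (underlyingSet xs - lookup xs i) ∪ ⁅ y ⁆
        xs′≡ = underlyingSet-update (basis⇒unique {xs} bxs) i y

        bxs′ : OrderedBasis (xs [ i ]≔ y)
        bxs′ = subst IsBasis (sym xs′≡) b

        -- The entry `y` lies in `ys`, so the difference gains nothing, and it loses `lookup xs i`.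
        xs′─ys⊂xs─ys : underlyingSet (xs [ i ]≔ y) ─ underlyingSet ys ⊂ underlyingSet xs ─ underlyingSet ys
        xs′─ys⊂xs─ys rewrite xs′≡ = sub , lookup xs i , x∈xs─ys , λ x∈ → x∉ (p─q⊆p _ (underlyingSet ys) x∈)
          where
          sub : ∀ {z} → z ∈ ((underlyingSet xs - lookup xs i) ∪ ⁅ y ⁆) ─ underlyingSet ys →
                z ∈ underlyingSet xs ─ underlyingSet ys
          sub z∈ with z∉ys ← x∈p─q⇒x∉q _ (underlyingSet ys) z∈
            with x∈p∪q⁻ (underlyingSet xs - lookup xs i) ⁅ y ⁆ (p─q⊆p _ (underlyingSet ys) z∈)
          ... | inj₁ z∈xs-x = x∈p∧x∉q⇒x∈p─q (p─q⊆p (underlyingSet xs) ⁅ lookup xs i ⁆ z∈xs-x) z∉ys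
          ... | inj₂ z∈⁅y⁆  = contradiction (subst (_∈ underlyingSet ys) (sym (x∈⁅y⁆⇒x≡y y z∈⁅y⁆)) y∈ys) z∉ys

          x∉ : lookup xs i ∉ (underlyingSet xs - lookup xs i) ∪ ⁅ y ⁆
          x∉ x∈ with x∈p∪q⁻ (underlyingSet xs - lookup xs i) ⁅ y ⁆ x∈
          ... | inj₁ x∈xs-x = x∈p─q⇒x∉q (underlyingSet xs) _ x∈xs-x (x∈⁅x⁆ _)
          ... | inj₂ x∈⁅y⁆  = y∉xs (subst (_∈ underlyingSet xs) (x∈⁅y⁆⇒x≡y y x∈⁅y⁆) x∈xs)

    basisExchangeInduction : ∀ xs ys → OrderedBasis xs → OrderedBasis ys → P xs ys
    basisExchangeInduction xs ys bxs bys = go {xs} {ys} bxs bys (<-wellFounded _)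

  module _ {c} (𝓖 : CommutativeMonoid c ℓ) where
    open CommutativeMonoid 𝓖
      renaming (refl to ≈-refl; sym to ≈-sym; trans to ≈-trans; reflexive to ≈-reflexive)
    open Products 𝓖

    -- An exchange replaces a factor `g x` by an equal factor `g y`. Cancellation is asked only for
    -- values of `g`, because the multiplicative monoid of a hyperfield contains zero.
    ∏-basis-constant : ∀ {g : Fin n → Carrier} → (∀ e {x y} → x ∙ g e ≈ y ∙ g e → x ≈ y) →
      (∀ {x y} → Exchangeable x y → g x ≈ g y) →
      ∀ xs ys → OrderedBasis xs → OrderedBasis ys → ∏ g xs ≈ ∏ g ys
    ∏-basis-constant {g} cancel g-const = basisExchangeInduction (λ xs ys → ∏ g xs ≈ ∏ g ys)
      (λ {xs} {ys} bxs bys xs≡ys → ≈-trans (∏≈∏ₛ g (basis⇒unique {xs} bxs))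
        (≈-trans (≈-reflexive (cong (∏ₛ g) xs≡ys)) (≈-sym (∏≈∏ₛ g (basis⇒unique {ys} bys)))))
      -- `∏-update` leaves `g y` on one side and `g x` on the other; `g-const` identifies them, and
      -- `cancel` removes the common factor.
      (λ {xs} {_} {i} {y} b b′ ∏xs′≈∏ys → ≈-trans
        (cancel y (≈-trans (≈-sym (∏-update g xs i y)) (∙-congˡ (g-const (xs , i , refl , b , b′)))))
        ∏xs′≈∏ys)

-- Arithmetic in a hyperfield.

module HyperfieldProperties (H : Hyperfield ℓ) where
  open Hyperfield H
  open IsGroup ⊙-isGroup using () renaming (inverseʳ to ⁻¹-inverseʳ)

  ⊙-commutativeMonoid : CommutativeMonoid ℓ ℓ
  ⊙-commutativeMonoid = record { isCommutativeMonoid = ⊙-isCommutativeMonoid }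

  open CommutativeMonoid ⊙-commutativeMonoid public
    using (∙-cong; ∙-congˡ; ∙-congʳ; identityˡ; identityʳ; assoc)
    renaming (refl to ≈-refl; sym to ≈-sym; trans to ≈-trans; reflexive to ≈-reflexive; comm to ⊙-comm)
  open CommutativeMonoidSolver ⊙-commutativeMonoid public using (solve; _⊕_; _⊜_)
  open Products ⊙-commutativeMonoid public

  ⊙-zeroʳ : ∀ x → x ⊙ 0# ≈ 0#
  ⊙-zeroʳ x = ≈-trans (⊙-comm x 0#) (⊙-zeroˡ x)

  ⊙-cancelʳ : ∀ z → NonZero z → ∀ {x y} → x ⊙ z ≈ y ⊙ z → x ≈ y
  ⊙-cancelʳ z z≉0 {x} {y} xz≈yz =
    ≈-trans (≈-sym (undo x)) (≈-trans (∙-congʳ xz≈yz) (undo y))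
    where
    undo : ∀ x → (x ⊙ z) ⊙ proj₁ ((z , z≉0) ⁻¹) ≈ x
    undo x = ≈-trans (assoc _ _ _)
             (≈-trans (∙-congˡ (⁻¹-inverseʳ (z , z≉0))) (identityʳ x))

  -‿unique : ∀ {x y} → (x ⊞ y) 0# → - x ≈ y
  -‿unique = proj₂ (proj₂ (⊞-inverse _))

  ∏-nonZero : ∀ (h : Fin n → Carrier*) (xs : Vec (Fin n) m) → NonZero (∏ (proj₁ ∘ h) xs)
  ∏-nonZero h []       = 1≉0
  ∏-nonZero h (x ∷ xs) = ⊙-nonZero (proj₂ (h x)) (∏-nonZero h xs)

  -- A repeated entry would force `φ xs` to vanish. For `φ` supported on the bases of `M`, this says
  -- that ordered bases have distinct entries.
  unique-support : {φ : Vec (Fin n) d → Carrier} → IsAlternating H φ →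
                   ∀ {xs} → NonZero (φ xs) → Unique xs
  unique-support alternating {xs} φxs≉0 =
    subst Unique (tabulate∘lookup xs) (tabulate⁺ lookup-inj)
    where
    lookup-inj : ∀ {i j} → lookup xs i ≡ lookup xs j → i ≡ j
    lookup-inj {i} {j} eq with i ≟ j
    ... | yes i≡j = i≡j
    ... | no i≢j  = contradiction (IsAlternating.vanishing alternating xs i≢j eq) φxs≉0

  isGP⇒alternating : ∀ k {φ : Vec (Fin n) d → Carrier} → IsGP H k φ → IsAlternating H φ
  isGP⇒alternating weak   = IsWeakGP.alternating
  isGP⇒alternating strong = IsStrongGP.alternating

  isGP⇒nonzero : ∀ k {φ : Vec (Fin n) d → Carrier} → IsGP H k φ → ∃ λ xs → NonZero (φ xs)
  isGP⇒nonzero weak   = IsWeakGP.nonzero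
  isGP⇒nonzero strong = IsStrongGP.nonzero

-- Transport of Grassmann-Plücker functions along the inclusion.

module SubHyperfieldProperties {H₂ : Hyperfield ℓ} (H₁ : SubHyperfield H₂) where
  open Hyperfield H₂
  open HyperfieldProperties H₂
  open SubHyperfield H₁ using (inclusion; hyperfield)

  private
    module H₁ = Hyperfield hyperfield
    module HP₁ = HyperfieldProperties hyperfield

  -- Equality in the sub-hyperfield is equality of underlying elements in `H₂`, so the proof of
  -- being nonzero is reused unchanged.
  inclusion* : H₁.Carrier* → Carrier*
  inclusion* (x , x≉0) = inclusion x , x≉0

  ⌊_⌋ : H₁.Carrier* → Carrier
  ⌊ x ⌋ = inclusion (proj₁ x)

  -- The hyperaddition is induced, so the negative taken in the sub-hyperfield is also one in `H₂`,
  -- where negatives are unique.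
  inclusion-‿- : ∀ x → inclusion (H₁.- x) ≈ - inclusion x
  inclusion-‿- x = ≈-sym (-‿unique (proj₁ (proj₂ (H₁.⊞-inverse x))))

  inclusion-[-1]^ : ∀ k → inclusion (H₁.[-1]^ k) ≈ [-1]^ k
  inclusion-[-1]^ zero    = ≈-refl
  inclusion-[-1]^ (suc k) = ∙-cong (inclusion-‿- H₁.1#) (inclusion-[-1]^ k)

  inclusion-∏ : ∀ (h : Fin n → H₁.Carrier) (xs : Vec (Fin n) m) →
                inclusion (HP₁.∏ h xs) ≈ ∏ (inclusion ∘ h) xs
  inclusion-∏ h []       = ≈-refl
  inclusion-∏ h (x ∷ xs) = ∙-congˡ (inclusion-∏ h xs)

  -- The partial sums that witness membership in the sub-hyperfield serve as witnesses in `H₂`.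
  inclusion-⨁ : ∀ {f : Fin m → H₁.Carrier} {g} → (∀ k → inclusion (f k) ≈ g k) →
                ∀ {z} → H₁.⨁ f z → ⨁ g (inclusion z)
  inclusion-⨁ {m = zero}  f≈g z≈0 = z≈0
  inclusion-⨁ {m = suc m} f≈g (a , b , a≈ , b∈ , z∈) =
    inclusion a , inclusion b , ≈-trans a≈ (f≈g zero) , inclusion-⨁ (f≈g ∘ suc) b∈ , z∈

  module _ {φ : Vec (Fin n) d → H₁.Carrier} where

    inclusion-alternating : IsAlternating hyperfield φ → IsAlternating H₂ (inclusion ∘ φ)
    inclusion-alternating alternating = record
      { antisymmetric = λ xs i≢j → ≈-trans (antisymmetric xs i≢j) (inclusion-‿- (φ xs))
      ; vanishing     = vanishing
      }
      where open IsAlternating alternating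

    inclusion-hasUnderlyingMatroid : ∀ {M} → HasUnderlyingMatroid hyperfield φ M →
                                     HasUnderlyingMatroid H₂ (inclusion ∘ φ) M
    inclusion-hasUnderlyingMatroid u = record { support = support ; off-support = off-support }
      where open HasUnderlyingMatroid u

  inclusion-relations : ∀ d {Admissible} {φ : Vec (Fin n) d → H₁.Carrier} →
    GPRelations hyperfield d Admissible φ → GPRelations H₂ d Admissible (inclusion ∘ φ)
  inclusion-relations zero    _         = _
  inclusion-relations (suc d) {φ = φ} relations xs ys xs! ys! admissible =
    inclusion-⨁ {f = λ k → (H₁.[-1]^ suc (toℕ k)) H₁.⊙ φ (removeAt xs k) H₁.⊙ φ (lookup xs k ∷ ys)}
                (λ k → ∙-congʳ (∙-congʳ (inclusion-[-1]^ (suc (toℕ k)))))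
                {H₁.0#} (relations xs ys xs! ys! admissible)

  inclusion-isGP : ∀ k {d} {φ : Vec (Fin n) d → H₁.Carrier} → IsGP hyperfield k φ → IsGP H₂ k (inclusion ∘ φ)
  inclusion-isGP weak   gp = record
    { nonzero     = nonzero
    ; alternating = inclusion-alternating alternating
    ; matroid     = let N , u = matroid in N , inclusion-hasUnderlyingMatroid u
    ; relations   = inclusion-relations _ relations
    }
    where open IsWeakGP gp
  inclusion-isGP strong gp = record
    { nonzero     = nonzero
    ; alternating = inclusion-alternating alternating
    ; relations   = inclusion-relations _ relations
    }
    where open IsStrongGP gp

  -- Ratios lying in the sub-hyperfield.

  -- The scalar is `q / p`, with the inverse taken in the sub-hyperfield. Ratios of elements of `H₂`
  -- are shown to lie in the sub-hyperfield through this cross-multiplied form.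
  quotient : ∀ (p q : H₁.Carrier*) {u v} → u ⊙ ⌊ p ⌋ ≈ ⌊ q ⌋ ⊙ v → ∃ λ c → u ≈ ⌊ c ⌋ ⊙ v
  quotient p q {u} {v} up≈qv = q H₁.⊙* (p H₁.⁻¹) , ⊙-cancelʳ ⌊ p ⌋ (proj₂ p) (≈-trans up≈qv (≈-sym
    (≈-trans (solve 4 (λ q r v p → ((q ⊕ r) ⊕ v) ⊕ p ⊜ (r ⊕ p) ⊕ (q ⊕ v)) ≈-refl _ _ _ _)
    (≈-trans (∙-congʳ (IsGroup.inverseˡ H₁.⊙-isGroup p))
             (identityˡ _)))))

  proportional : ∀ {A : Set} {f g : A → H₁.Carrier} {b} →
    (∀ x → inclusion (f x) ≈ b ⊙ inclusion (g x)) →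
    ∀ {x₀} → H₁.NonZero (f x₀) → H₁.NonZero (g x₀) →
    ∃ λ c → H₁.NonZero c × (∀ x → f x H₁.≈ c H₁.⊙ g x)
  proportional {f = f} {g} {b} f≈bg {x₀} f≉0 g≉0 =
    -- Evaluation at `x₀` gives `b = f x₀ / g x₀`; taking `v` to be `1#` isolates `b`.
    let (c , c≉0) , b≈c = quotient (g x₀ , g≉0) (f x₀ , f≉0) {b} {1#}
                            (≈-trans (≈-sym (f≈bg x₀)) (≈-sym (identityʳ _)))
    in c , c≉0 , λ x → ≈-trans (f≈bg x) (∙-congʳ (≈-trans b≈c (identityʳ _)))

  -- The values `h x` and `h y` lie in the same coset of `H₁*` in `H₂*`.
  Commensurable : (Fin n → Carrier*) → Rel (Fin n) ℓ
  Commensurable h x y = ∃ λ c → proj₁ (h x) ≈ ⌊ c ⌋ ⊙ proj₁ (h y)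

  commensurable-isEquivalence : ∀ (h : Fin n → Carrier*) → IsEquivalence (Commensurable h)
  commensurable-isEquivalence h = record
    { refl  = H₁.1* , ≈-sym (identityˡ _)
    ; sym   = λ (c , hx≈chy) → quotient c H₁.1*
                (≈-trans (⊙-comm _ _) (≈-trans (≈-sym hx≈chy)
                  (≈-sym (identityˡ _))))
    ; trans = λ (c , p) (c′ , q) → c H₁.⊙* c′ ,
                ≈-trans p (≈-trans (∙-congˡ q) (≈-sym (assoc _ _ _)))
    }

  -- Well-definedness and injectivity of the induced maps.

  module _ (M : Matroid n) (k : Strength) where
    open Matroid M using (rank)
    module S₁ = Space k hyperfield M
    module S₂ = Space k H₂ M

    include : S₁.GP → S₂.GP
    include (φ , gp , u) = inclusion ∘ φ , inclusion-isGP k gp , inclusion-hasUnderlyingMatroid u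

    basis⇒nonZero : ∀ (φ : S₁.GP) {xs} → Matroid.IsBasis M (underlyingSet xs) → H₁.NonZero (proj₁ φ xs)
    basis⇒nonZero (φ , _ , u) = Equivalence.from (HasUnderlyingMatroid.support u _)

    nonZero⇒basis : ∀ (φ : S₁.GP) {xs} → H₁.NonZero (proj₁ φ xs) → Matroid.IsBasis M (underlyingSet xs)
    nonZero⇒basis (φ , _ , u) = Equivalence.to (HasUnderlyingMatroid.support u _)

    include-∼-cong : ∀ {φ ψ : S₁.GP} → proj₁ φ S₁.∼ proj₁ ψ → proj₁ (include φ) S₂.∼ proj₁ (include ψ)
    include-∼-cong (a , a≉0 , φ≈aψ) = inclusion a , a≉0 , φ≈aψ

    include-≋-cong : ∀ {φ ψ : S₁.GP} → proj₁ φ S₁.≋ proj₁ ψ → proj₁ (include φ) S₂.≋ proj₁ (include ψ)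
    include-≋-cong (h , a , a≉0 , φ≈ahψ) = inclusion* ∘ h , inclusion a , a≉0 ,
      λ xs → ≈-trans (φ≈ahψ xs) (∙-congˡ (∙-congʳ (inclusion-∏ (proj₁ ∘ h) xs)))

    include-∼-injective : ∀ {φ ψ : S₁.GP} → proj₁ (include φ) S₂.∼ proj₁ (include ψ) → proj₁ φ S₁.∼ proj₁ ψ
    include-∼-injective {φ} {ψ} (a , _ , φ≈aψ) =
      let x₀ , φx₀≉0 = HP₁.isGP⇒nonzero k (proj₁ (proj₂ φ))
      -- Both functions are supported on the ordered bases of `M`, so `ψ` is nonzero at `x₀` as
      -- well.
      in proportional {f = proj₁ φ} {proj₁ ψ} φ≈aψ φx₀≉0 (basis⇒nonZero ψ (nonZero⇒basis φ φx₀≉0))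

    module _ {φ ψ : S₁.GP} (h : Fin n → Carrier*) {a : Carrier}
      (φ≈ahψ : ∀ xs → inclusion (proj₁ φ xs) ≈ a ⊙ (∏ (proj₁ ∘ h) xs ⊙ inclusion (proj₁ ψ xs))) where

      open BasisExchange M rank
        (λ b → HP₁.unique-support (HP₁.isGP⇒alternating k (proj₁ (proj₂ φ))) (basis⇒nonZero φ b))

      -- Dividing `φ / ψ` at `xs′` by `φ / ψ` at `xs` cancels `a` and every factor of `h` except
      -- those at `x` and `y`, leaving `h y / h x`. All four values are nonzero elements of the
      -- sub-hyperfield.
      exchangeable⇒commensurable : ∀ {x y} → Exchangeable x y → Commensurable h x y
      exchangeable⇒commensurable {y = y} (xs , i , refl , b , b′) =
        quotient (φ* b′ H₁.⊙* ψ* b) (φ* b H₁.⊙* ψ* b′) (begin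
          η x ⊙ (inclusion (proj₁ φ xs′) ⊙ s)   ≈⟨ ∙-congˡ (∙-congʳ (φ≈ahψ xs′)) ⟩
          η x ⊙ ((a ⊙ (∏ η xs′ ⊙ s′)) ⊙ s)      ≈⟨ solve 5 (λ x a p s′ s →
                                                     x ⊕ ((a ⊕ (p ⊕ s′)) ⊕ s) ⊜ (p ⊕ x) ⊕ (a ⊕ (s ⊕ s′)))
                                                     ≈-refl (η x) a (∏ η xs′) s′ s ⟩
          (∏ η xs′ ⊙ η x) ⊙ (a ⊙ (s ⊙ s′))      ≈⟨ ∙-congʳ (∏-update η xs i y) ⟩
          (∏ η xs ⊙ η y) ⊙ (a ⊙ (s ⊙ s′))       ≈⟨ solve 5 (λ p y a s s′ →
                                                     (p ⊕ y) ⊕ (a ⊕ (s ⊕ s′)) ⊜ ((a ⊕ (p ⊕ s)) ⊕ s′) ⊕ y)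
                                                     ≈-refl (∏ η xs) (η y) a s s′ ⟩
          ((a ⊙ (∏ η xs ⊙ s)) ⊙ s′) ⊙ η y       ≈⟨ ∙-congʳ (∙-congʳ (φ≈ahψ xs)) ⟨
          (inclusion (proj₁ φ xs) ⊙ s′) ⊙ η y   ∎)
        where
        open SetoidReasoning setoid
        η   = proj₁ ∘ h
        x   = lookup xs i
        xs′ = xs [ i ]≔ y
        s   = inclusion (proj₁ ψ xs)
        s′  = inclusion (proj₁ ψ xs′)
        φ* ψ* : ∀ {xs} → OrderedBasis xs → H₁.Carrier*
        φ* {xs} b = proj₁ φ xs , basis⇒nonZero φ b
        ψ* {xs} b = proj₁ ψ xs , basis⇒nonZero ψ b

      rescaling-descends : proj₁ φ S₁.≋ proj₁ ψ
      rescaling-descends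
        -- Commensurability need not be decidable, so classes are merged along the decidable
        -- relation `Exchangeable`; each `x` remains commensurable with `rep x`.
        with rep , h~rep , rep-const ← classRepresentatives (commensurable-isEquivalence h)
                                         exchangeable? exchangeable⇒commensurable
           | x₀ , φx₀≉0 ← HP₁.isGP⇒nonzero k (proj₁ (proj₂ φ)) =
        h′ , proportional {f = proj₁ φ} {S₁.rescale h′ (proj₁ ψ)} φ≈bh′ψ φx₀≉0
               (H₁.⊙-nonZero {HP₁.∏ (proj₁ ∘ h′) x₀} {proj₁ ψ x₀} (HP₁.∏-nonZero h′ x₀)
                             (basis⇒nonZero ψ {x₀} b₀))
        where
        h′ : Fin n → H₁.Carrier*
        h′ = proj₁ ∘ h~rep

        g : Fin n → Carrier*
        g = h ∘ rep

        b₀ : OrderedBasis x₀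
        b₀ = nonZero⇒basis φ φx₀≉0

        K : Carrier
        K = ∏ (proj₁ ∘ g) x₀

        φ≈bh′ψ : ∀ xs → inclusion (proj₁ φ xs) ≈
                 (a ⊙ K) ⊙ inclusion (S₁.rescale h′ (proj₁ ψ) xs)
        φ≈bh′ψ xs with T? (Matroid.isBasis M (underlyingSet xs))
        -- Away from the bases the product of `g` need not equal `K`, but there `φ` and `ψ` both
        -- vanish.
        ... | no ¬b = ≈-trans (HasUnderlyingMatroid.off-support (proj₂ (proj₂ φ)) xs ¬b)
          (≈-sym (≈-trans (∙-congˡ (≈-trans (∙-congˡ (HasUnderlyingMatroid.off-support (proj₂ (proj₂ ψ)) xs ¬b))
            (⊙-zeroʳ _))) (⊙-zeroʳ _)))
        ... | yes b = begin
          inclusion (proj₁ φ xs)            ≈⟨ φ≈ahψ xs ⟩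
          a ⊙ (∏ (proj₁ ∘ h) xs ⊙ s)        ≈⟨ ∙-congˡ (∙-congʳ (∏-∙ (proj₂ ∘ h~rep) xs)) ⟩
          a ⊙ ((p ⊙ ∏ (proj₁ ∘ g) xs) ⊙ s)  ≈⟨ ∙-congˡ (∙-congʳ (∙-congˡ ∏g≈K)) ⟩
          a ⊙ ((p ⊙ K) ⊙ s)                 ≈⟨ solve 4 (λ a p k s → a ⊕ ((p ⊕ k) ⊕ s) ⊜ (a ⊕ k) ⊕ (p ⊕ s))
                                                 ≈-refl a p K s ⟩
          (a ⊙ K) ⊙ (p ⊙ s)                 ≈⟨ ∙-congˡ (∙-congʳ (inclusion-∏ (proj₁ ∘ h′) xs)) ⟨
          (a ⊙ K) ⊙ inclusion (S₁.rescale h′ (proj₁ ψ) xs) ∎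
          where
          ∏g≈K : ∏ (proj₁ ∘ g) xs ≈ K
          ∏g≈K = ∏-basis-constant ⊙-commutativeMonoid (λ e → ⊙-cancelʳ _ (proj₂ (g e)))
                   (≈-reflexive ∘ cong (proj₁ ∘ h) ∘ rep-const) xs x₀ b b₀

          open SetoidReasoning setoid
          p = ∏ (⌊_⌋ ∘ h′) xs
          s = inclusion (proj₁ ψ xs)

    include-≋-injective : ∀ {φ ψ : S₁.GP} → proj₁ (include φ) S₂.≋ proj₁ (include ψ) → proj₁ φ S₁.≋ proj₁ ψ
    include-≋-injective {φ} {ψ} (h , _ , _ , φ≈ahψ) = rescaling-descends {φ} {ψ} h φ≈ahψ

    𝓜-injection : Injection S₁.𝓜 S₂.𝓜
    𝓜-injection = record
      { to        = include
      ; cong      = λ {φ} {ψ} → include-∼-cong {φ} {ψ}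
      ; injective = λ {φ} {ψ} → include-∼-injective {φ} {ψ}
      }

    𝓡-injection : Injection S₁.𝓡 S₂.𝓡
    𝓡-injection = record
      { to        = include
      ; cong      = λ {φ} {ψ} → include-≋-cong {φ} {ψ}
      ; injective = λ {φ} {ψ} → include-≋-injective {φ} {ψ}
      }

    -- Continuity.

    module _ (τ₁ : HyperfieldTopology hyperfield) (τ₂ : HyperfieldTopology H₂)
      (inclusion-continuous : Continuous (HyperfieldTopology.topology τ₁)
                                         (HyperfieldTopology.topology τ₂) inclusion) where

      -- Open sets of the quotient are saturated traces of open sets `V` of the power. Composition
      -- with the inclusion acts coordinatewise, so a basic neighbourhood pulls back to one
      -- constraining the same finite list of coordinates.
      𝓜-continuous : Continuous (S₁.𝓜-topology τ₁) (S₂.𝓜-topology τ₂) include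
      𝓜-continuous (U-resp-∼ , V , V-open , U⊆V , V⊆U) =
        (λ {φ} {ψ} → U-resp-∼ ∘ include-∼-cong {φ} {ψ})
        , (λ φ → V (inclusion ∘ φ))
        , (λ φ∈V → let as , W , W-open , φ∈W , W⊆V = V-open φ∈V in
                   as , (λ a → W a ∘ inclusion) , (λ a → inclusion-continuous (W-open a)) , φ∈W , W⊆V)
        , U⊆V , V⊆U

      -- The topology on `𝓡` is the quotient of that on `𝓜`, so only saturation under `≋` has to be
      -- added to `𝓜-continuous`.
      𝓡-continuous : Continuous (S₁.𝓡-topology τ₁) (S₂.𝓡-topology τ₂) include
      𝓡-continuous (U-resp-≋ , U-open) =
        (λ {φ} {ψ} → U-resp-≋ ∘ include-≋-cong {φ} {ψ}) , 𝓜-continuous U-open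

theorem4p8 : ∀ {ℓ : Level} {n : ℕ} (M : Matroid n) (H₂ : Hyperfield ℓ) (H₁ : SubHyperfield H₂) (k : Strength) →
    let module S₁ = Space k (SubHyperfield.hyperfield H₁) M
        module S₂ = Space k H₂ M
    in
    Σ[ i ∈ Injection S₁.𝓜 S₂.𝓜 ] Σ[ j ∈ Injection S₁.𝓡 S₂.𝓡 ]
      (∀ (τ₁ : HyperfieldTopology (SubHyperfield.hyperfield H₁)) (τ₂ : HyperfieldTopology H₂) →
       Continuous (HyperfieldTopology.topology τ₁) (HyperfieldTopology.topology τ₂) (SubHyperfield.inclusion H₁) →
       Continuous (S₁.𝓜-topology τ₁) (S₂.𝓜-topology τ₂) (Injection.to i)
       × Continuous (S₁.𝓡-topology τ₁) (S₂.𝓡-topology τ₂) (Injection.to j))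
theorem4p8 M H₂ H₁ k =
  𝓜-injection M k , 𝓡-injection M k ,
  λ τ₁ τ₂ c → 𝓜-continuous M k τ₁ τ₂ c , 𝓡-continuous M k τ₁ τ₂ c
  where open SubHyperfieldProperties H₁
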